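{- Let $\mathcal M$ be a map on a surface with $n$ edges, let $E$ be its set of edges, identified with $[n]$, and let $A\subseteq E$. If $(X|Y)$ is a representation of the Lagrangian matroid $\Delta(\mathcal M)$, then a representation of the Lagrangian matroid $\Delta(\partial_A\mathcal M)$ of the partial dual $\partial_A\mathcal M$ is obtained from $(X|Y)$ by interchanging the columns $j$ and $j^*$ for all $j\in A$.
   Context: A map $\mathcal M$ on a surface $S$ is a cellular embedding of a connected graph (loops and multiple edges allowed) into a connected, closed, orientable surface $S$; the components of the complement are the faces. The dual map $\mathcal M^*$ on $S$ has one vertex (covertex) in each face of $\mathcal M$, and for each edge $j$ of $\mathcal M$ an edge (coedge) $j^*$ joining the face-centres of the face(s) on the two sides of $j$, crossing $j$ exactly once and meeting no other edge of $\mathcal M$. Write $E=[n]=\{1,\dots,n\}$ for the edges and $E^*=[n]^*=\{1^*,\dots,n^*\}$ for the coedges. An $n$-subset of $[n]\cup[n]^*$ is admissible if for each $j\in[n]$ it contains exactly one of $j,j^*$. A base of $\mathcal M$ is an admissible $n$-subset $B$ such that $S\setminus B$ (the complement of the union of the edges and coedges in $B$) is connected. The bases of $\mathcal M$ form the bases of a Lagrangian matroid $\Delta(\mathcal M)$, i.e. a collection $\mathcal B$ of admissible $n$-subsets such that for all $B_1,B_2\in\mathcal B$ and $j\in B_1\bigtriangleup B_2$ there is $k\in B_2\bigtriangleup B_1$ with $B_1\bigtriangleup\{j,k,j^*,k^*\}\in\mathcal B$. Representation: let $\mathbb F$ be a field of characteristic $0$ (e.g. $\mathbb Q$). A representation over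 $\mathbb F$ of a Lagrangian matroid with bases $\mathcal B$ on $[n]\cup[n]^*$ is an $n\times 2n$ matrix $(X|Y)$ over $\mathbb F$ of rank $n$, with $X,Y$ of size $n\times n$ and columns indexed by $[n]$ and $[n]^*$ respectively, such that $XY^t$ is anti-symmetric and such that an admissible $n$-subset $B$ lies in $\mathcal B$ if and only if the $n\times n$ minor of $(X|Y)$ on the columns indexed by $B$ is non-zero. Equivalently, the rows span a Lagrangian (maximal isotropic) subspace of the standard orthogonal space, the $2n$-dimensional space with basis $e_1,\dots,e_n,e_{1^*},\dots,e_{n^*}$ and symmetric bilinear form with $\langle e_i,e_{i^*}\rangle=\langle e_{i^*},e_i\rangle=1$ and $\langle e_i,e_j\rangle=0$ for $i\neq j^*$. Partial dual: divide each edge into two half-edges and label the half-edges by $\{1,\dots,2n\}$. Then $\mathcal M$ is encoded by $\langle\sigma,\alpha,\varphi\rangle$, $\sigma,\alpha,\varphi\in S_{2n}$, where cycles of $\sigma$, $\alpha$, $\varphi$ are the counter-clockwise cyclic orderings of half-edge labels around vertices, around edge midpoints, and within faces, respectively; $\alpha$ is a fixed-point free involution, $\sigma\alpha\varphi=1$ (permutations act on the right), and the group generated is transitive; conversely such a triple determines a map up to isomorphism. Write $\alpha=c_1\cdots c_n$ as a product of disjoint transpositions, $c_j$ corresponding to edge $j$. For $A=\{i_1,\dots,i_k\}\subseteq E$, $\partial_A\mathcal M=\langle\sigma c_{i_1}\cdots c_{i_k},\alpha,c_{i_1}\cdots c_{i_k}\varphi\rangle$. Its edge $j$ is again the one corresponding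 to $c_j$, and its coedge is again denoted $j^*$, so $\Delta(\partial_A\mathcal M)$ is a Lagrangian matroid on the same set $[n]\cup[n]^*$. -}

module Defs where

open import Level using (_⊔_; 0ℓ)
open import Algebra.Apartness.Bundles using (HeytingField; HeytingCommutativeRing)
open import Algebra.Bundles using (CommutativeRing)
import Algebra.Properties.Monoid.Sum as MonoidSum
import Algebra.Properties.Monoid.Mult as MonoidMult
import Algebra.Properties.Semiring.Exp as SemiringExp
open import Data.Bool.Base using (Bool; true; false; not; _∨_; _xor_; if_then_else_)
open import Data.Bool.Properties using (∨-identityʳ; ∨-comm; ∨-idem; xor-assoc; xor-comm; xor-identityʳ; not-involutive; not-distribˡ-xor) renaming (_≟_ to _≟ᵇ_)
open import Data.Empty using (⊥-elim)
open import Data.Fin.Base using (Fin; zero; suc; toℕ; fromℕ<; punchIn)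
open import Data.Fin.Permutation using (Permutation′; permutation; _⟨$⟩ʳ_; _⟨$⟩ˡ_; _∘ₚ_; _≈_; id; inverseˡ; inverseʳ)
open import Data.Fin.Properties using (_≟_; pigeonhole; any?; toℕ-fromℕ<; toℕ<n)
open import Data.Fin.Subset using (Subset)
open import Data.Fin.Subset.Properties using (_∈?_)
open import Data.List.Base using (List; []; _∷_; foldr; filter; allFin)
open import Data.List.Relation.Unary.All as All using (All; []; _∷_)
open import Data.List.Relation.Unary.AllPairs using ([]; _∷_)
open import Data.List.Relation.Unary.Any using (here; there)
open import Data.List.Relation.Unary.Unique.Propositional using (Unique)
open import Data.List.Relation.Unary.Unique.Propositional.Properties using (filter⁺; allFin⁺)
import Data.List.Membership.DecPropositional as DecMembership
open import Data.Nat.Base as ℕ using (ℕ; zero; suc; s≤s; NonZero)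
import Data.Nat.Properties as ℕₚ
import Data.Nat.DivMod as ℕ÷
open import Data.Product.Base using (Σ; ∃-syntax; _×_; _,_; proj₁; proj₂)
open import Data.Sum.Base as Sum using (_⊎_; inj₁; inj₂; [_,_]′)
import Data.Sum.Properties as Sumₚ
open import Function.Base using (_∘_)
open import Function.Bundles using (_⇔_)
open import Relation.Binary.Construct.Closure.Equivalence as Eq using (EqClosure)
open import Relation.Binary.Construct.Closure.ReflexiveTransitive using (ε; _◅_; _◅◅_)
open import Relation.Binary.Construct.Closure.Symmetric using (fwd; bwd)
open import Relation.Binary.Core using (Rel)
open import Relation.Binary.Definitions using (DecidableEquality)
open import Relation.Binary.PropositionalEquality using (_≡_; _≢_; refl; sym; trans; cong; subst; module ≡-Reasoning)
open import Relation.Nullary using (¬_; Dec; yes; no; does; contradiction)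
open import Relation.Nullary.Decidable using (map′; _×-dec_; ¬?; dec-true; dec-false)
open import Relation.Unary using (Pred)

-- inj₁ j is the element j, and inj₂ j is the element j*.
Ground : ℕ → Set
Ground n = Fin n ⊎ Fin n

_* : ∀ {n} → Ground n → Ground n
_* = Sum.swap

index : ∀ {n} → Ground n → Fin n
index = [ (λ j → j) , (λ j → j) ]′

_≟ᴳ_ : ∀ {n} → DecidableEquality (Ground n)
_≟ᴳ_ = Sumₚ.≡-dec _≟_ _≟_

GroundSubset : ℕ → Set
GroundSubset n = Ground n → Bool

infix 4 _∈ᴳ_

_∈ᴳ_ : ∀ {n} → Ground n → GroundSubset n → Set
x ∈ᴳ B = B x ≡ true

infixl 6 _△_

_△_ : ∀ {n} → GroundSubset n → GroundSubset n → GroundSubset n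
(B △ C) x = B x xor C x

-- The set {j, k, j*, k*}.
pairs : ∀ {n} → Ground n → Ground n → GroundSubset n
pairs j k x = does (x ≟ᴳ j) ∨ does (x ≟ᴳ k) ∨ does (x ≟ᴳ (j *)) ∨ does (x ≟ᴳ (k *))

-- Exactly one of j and j* lies in B, for every j; such a B automatically
-- has n elements.
Admissible : ∀ {n} → Pred (GroundSubset n) 0ℓ
Admissible B = ∀ j → B (inj₂ j) ≡ not (B (inj₁ j))

record LagrangianMatroid (n : ℕ) : Set₁ where
  field
    IsBase     : Pred (GroundSubset n) 0ℓ
    admissible : ∀ B → IsBase B → Admissible B
    exchange   : ∀ B₁ B₂ → IsBase B₁ → IsBase B₂ →
                 ∀ j → j ∈ᴳ (B₁ △ B₂) →
                 ∃[ k ] (k ∈ᴳ (B₂ △ B₁)) × IsBase (B₁ △ pairs j k)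

SameCycle : ∀ {m} → Permutation′ m → Rel (Fin m) 0ℓ
SameCycle π = EqClosure (λ g h → π ⟨$⟩ʳ g ≡ h)

closure-map : ∀ {a ℓ ℓ′} {A : Set a} {R : Rel A ℓ} {S : Rel A ℓ′} →
              (∀ {x y} → R x y → EqClosure S x y) → ∀ {x y} → EqClosure R x y → EqClosure S x y
closure-map f ε            = ε
closure-map f (fwd r ◅ rs) = f r ◅◅ closure-map f rs
closure-map f (bwd r ◅ rs) = Eq.symmetric _ (f r) ◅◅ closure-map f rs

-- Permutations act on the right, so the product πρ is π ∘ₚ ρ, which applies
-- π first.
record Map (n : ℕ) : Set where
  HalfEdge : Set
  HalfEdge = Fin (2 ℕ.* n)

  field
    σ α φ : Permutation′ (2 ℕ.* n)

    α-involutive     : (α ∘ₚ α) ≈ id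
    α-fixedPointFree : ∀ h → α ⟨$⟩ʳ h ≢ h
    σαφ≈id           : (σ ∘ₚ α ∘ₚ φ) ≈ id
    transitive       : ∀ g h → EqClosure
      (λ x y → (σ ⟨$⟩ʳ x ≡ y) ⊎ (α ⟨$⟩ʳ x ≡ y) ⊎ (φ ⟨$⟩ʳ x ≡ y)) g h

    -- The identification of the edges, i.e. of the cycles of α, with [n].
    edge            : HalfEdge → Fin n
    edge-surjective : ∀ j → ∃[ h ] edge h ≡ j
    edge-α          : ∀ h → edge (α ⟨$⟩ʳ h) ≡ edge h
    edge-injective  : ∀ g h → edge g ≡ edge h → g ≡ h ⊎ g ≡ α ⟨$⟩ʳ h

  c-fun : Fin n → HalfEdge → HalfEdge
  c-fun j h = if does (edge h ≟ j) then α ⟨$⟩ʳ h else h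

  c-fun-involutive : ∀ j h → c-fun j (c-fun j h) ≡ h
  c-fun-involutive j h with edge h ≟ j
  ... | yes p rewrite dec-true (edge (α ⟨$⟩ʳ h) ≟ j) (trans (edge-α h) p) = α-involutive h
  ... | no ¬p rewrite dec-false (edge h ≟ j) ¬p = refl

  -- The transposition cⱼ in the factorisation α = c₁⋯cₙ.
  c : Fin n → Permutation′ (2 ℕ.* n)
  c j = permutation (c-fun j) (c-fun j) (c-fun-involutive j) (c-fun-involutive j)

  productOf : List (Fin n) → Permutation′ (2 ℕ.* n)
  productOf = foldr (λ j π → c j ∘ₚ π) id

  -- The product of the cⱼ over all j ∈ A.
  c[_] : Subset n → Permutation′ (2 ℕ.* n)
  c[ A ] = productOf (filter (_∈? A) (allFin n))

module _ {n : ℕ} (M : Map n) where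
  open Map M
  open DecMembership (_≟_ {n}) using (_∈_; _∉_) renaming (_∈?_ to _∈ˡ?_)

  private
    ∉⇒All : ∀ {i js} → i ∉ js → All (i ≢_) js
    ∉⇒All {js = js} i∉ = All.tabulate λ x∈ e → i∉ (subst (_∈ js) (sym e) x∈)

    productOf-∉ : ∀ js h → All (edge h ≢_) js → productOf js ⟨$⟩ʳ h ≡ h
    productOf-∉ [] h _ = refl
    productOf-∉ (j ∷ js) h (h≢j ∷ ∉js) rewrite dec-false (edge h ≟ j) h≢j = productOf-∉ js h ∉js

    productOf-∈ : ∀ js → Unique js → ∀ h → edge h ∈ js → productOf js ⟨$⟩ʳ h ≡ α ⟨$⟩ʳ h
    productOf-∈ (j ∷ js) (j∉js ∷ u) h h∈ with edge h ≟ j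
    productOf-∈ (j ∷ js) (j∉js ∷ u) h h∈ | yes refl =
      productOf-∉ js _ (All.map (λ j≢ e → j≢ (trans (sym (edge-α h)) e)) j∉js)
    productOf-∈ (j ∷ js) (j∉js ∷ u) h (here e)   | no ¬e = contradiction e ¬e
    productOf-∈ (j ∷ js) (j∉js ∷ u) h (there h∈) | no ¬e = productOf-∈ js u h h∈

  productOf-cases : ∀ js → Unique js → ∀ h →
                    (productOf js ⟨$⟩ʳ h ≡ h × edge h ∉ js) ⊎
                    (productOf js ⟨$⟩ʳ h ≡ α ⟨$⟩ʳ h × edge h ∈ js)
  productOf-cases js u h with edge h ∈ˡ? js
  ... | yes h∈ = inj₂ (productOf-∈ js u h h∈ , h∈)
  ... | no h∉  = inj₁ (productOf-∉ js h (∉⇒All h∉) , h∉)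

  private
    conjugate : ∀ js → Unique js → ∀ h →
                productOf js ⟨$⟩ʳ (α ⟨$⟩ʳ (productOf js ⟨$⟩ʳ h)) ≡ α ⟨$⟩ʳ h
    conjugate js u h with productOf-cases js u h
    ... | inj₁ (e , h∉) rewrite e = productOf-∉ js _ (∉⇒All (h∉ ∘ subst (_∈ js) (edge-α h)))
    ... | inj₂ (e , h∈) rewrite e | α-involutive h = e

  module _ (A : Subset n) where
    private
      js  = filter (_∈? A) (allFin n)
      js! : Unique js
      js! = filter⁺ (_∈? A) (allFin⁺ n)

      σ′ φ′ : Permutation′ (2 ℕ.* n)
      σ′ = σ ∘ₚ c[ A ]
      φ′ = c[ A ] ∘ₚ φ

      Step′ : Rel HalfEdge 0ℓ
      Step′ x y = (σ′ ⟨$⟩ʳ x ≡ y) ⊎ (α ⟨$⟩ʳ x ≡ y) ⊎ (φ′ ⟨$⟩ʳ x ≡ y)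

      via-c : ∀ h → EqClosure Step′ h (c[ A ] ⟨$⟩ʳ h)
      via-c h with productOf-cases js js! h
      ... | inj₁ (e , _) = subst (EqClosure Step′ h) (sym e) ε
      ... | inj₂ (e , _) = fwd (inj₂ (inj₁ (sym e))) ◅ ε

      via-σ : ∀ h → EqClosure Step′ h (σ ⟨$⟩ʳ h)
      via-σ h = fwd (inj₁ refl) ◅ Eq.symmetric Step′ (via-c (σ ⟨$⟩ʳ h))

      via-φ : ∀ h → EqClosure Step′ h (φ ⟨$⟩ʳ h)
      via-φ h = subst (λ x → EqClosure Step′ x (φ ⟨$⟩ʳ h)) c-g
        (Eq.symmetric Step′ (via-c g) ◅◅ fwd (inj₂ (inj₂ (cong (φ ⟨$⟩ʳ_) c-g))) ◅ ε)
        where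
        g   = c[ A ] ⟨$⟩ˡ h
        c-g = inverseʳ c[ A ] {h}

    ∂ : Map n
    ∂ = record
      { σ                = σ′
      ; α                = α
      ; φ                = φ′
      ; α-involutive     = α-involutive
      ; α-fixedPointFree = α-fixedPointFree
      ; σαφ≈id           = λ h → trans (cong (φ ⟨$⟩ʳ_) (conjugate js js! (σ ⟨$⟩ʳ h))) (σαφ≈id h)
      ; transitive       = λ g h → closure-map
          (λ { {x} (inj₁ refl)        → via-σ x
             ; (inj₂ (inj₁ refl))     → fwd (inj₂ (inj₁ refl)) ◅ ε
             ; {x} (inj₂ (inj₂ refl)) → via-φ x })
          (transitive g h)
      ; edge             = edge
      ; edge-surjective  = edge-surjective
      ; edge-α           = edge-α
      ; edge-injective   = edge-injective
      }

-- The superposition of M and M* divides the surface into open cells.  A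
-- vertex is a cycle of σ and a covertex is a cycle of φ, so each of them is
-- named by any of the half-edges in its cycle.  The face traversed by the
-- cycle of φ through h lies to the left of h, looking along h away from its
-- vertex; coHalfEdge h is the half of (edge h)* lying to the left of h.
-- corner h is the quadrilateral between h and σ h at their common vertex, on
-- the left of h; its sides are the halves of edges h and σ h and the halves
-- of coedges to the left of h and to the right of σ h.  (For n = 0 the
-- surface is a sphere, and no cell is named: its single vertex and single
-- face carry no half-edge.)
module Surface {n : ℕ} (M : Map n) where
  open Map M

  data Cell : Set where
    vertex covertex     : HalfEdge → Cell
    crossing            : Fin n → Cell
    halfEdge coHalfEdge : HalfEdge → Cell
    corner              : HalfEdge → Cell

  infix 4 _◁_

  -- The first cell lies in the boundary of the second, and its dimension is
  -- one lower.
  data _◁_ : Rel Cell 0ℓ where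
    vertex◁       : ∀ {g h} → SameCycle σ g h → vertex g ◁ halfEdge h
    covertex◁     : ∀ {g h} → SameCycle φ g h → covertex g ◁ coHalfEdge h
    crossing◁     : ∀ h → crossing (edge h) ◁ halfEdge h
    crossing◁*    : ∀ h → crossing (edge h) ◁ coHalfEdge h
    halfEdge◁     : ∀ h → halfEdge h ◁ corner h
    halfEdge-σ◁   : ∀ h → halfEdge (σ ⟨$⟩ʳ h) ◁ corner h
    coHalfEdge◁   : ∀ h → coHalfEdge h ◁ corner h
    coHalfEdge-σ◁ : ∀ h → coHalfEdge (α ⟨$⟩ʳ (σ ⟨$⟩ʳ h)) ◁ corner h

  -- The cells contained in the union of the (closed) edges and coedges in B.
  data OnUnion (B : GroundSubset n) : Pred Cell 0ℓ where
    onEdge   : ∀ {h} → inj₁ (edge h) ∈ᴳ B → OnUnion B (halfEdge h)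
    onCoedge : ∀ {h} → inj₂ (edge h) ∈ᴳ B → OnUnion B (coHalfEdge h)
    closed   : ∀ {x y} → x ◁ y → OnUnion B y → OnUnion B x

  InComplement : GroundSubset n → Pred Cell 0ℓ
  InComplement B x = ¬ OnUnion B x

  -- The complement of the union is itself a union of open cells, and it is
  -- connected if and only if any two of these cells are joined by a chain of
  -- successively incident cells inside the complement.
  ComplementConnected : Pred (GroundSubset n) 0ℓ
  ComplementConnected B = ∀ {x y} → InComplement B x → InComplement B y →
    EqClosure (λ u v → InComplement B u × InComplement B v × u ◁ v) x y

  Base : Pred (GroundSubset n) 0ℓ
  Base B = Admissible B × ComplementConnected B

-- An auxiliary criterion, used to verify the exchange axiom: the complement
-- of B is connected if and only if the permutation sending h to σ⁻¹(α h) or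
-- σ⁻¹ h, according to whether edge h or its coedge lies in B, has a single cycle.
module Boundary {n : ℕ} (M : Map n) where
  open Map M
  open Surface M

  turn : GroundSubset n → HalfEdge → HalfEdge
  turn B h = if B (inj₁ (edge h)) then α ⟨$⟩ʳ h else h

  boundary : GroundSubset n → HalfEdge → HalfEdge
  boundary B h = σ ⟨$⟩ˡ turn B h

  infix 4 _∼[_]_
  _∼[_]_ : HalfEdge → GroundSubset n → HalfEdge → Set
  g ∼[ B ] h = EqClosure (λ x y → boundary B x ≡ y) g h

  ∼-sym : ∀ {B g h} → g ∼[ B ] h → h ∼[ B ] g
  ∼-sym {B} = Eq.symmetric (λ x y → boundary B x ≡ y)

  SingleCycle : Pred (GroundSubset n) 0ℓ
  SingleCycle B = ∀ g h → g ∼[ B ] h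

  private
    false≢true : ¬ (false ≡ true)
    false≢true ()

    φ≡ : ∀ h → φ ⟨$⟩ʳ h ≡ σ ⟨$⟩ˡ (α ⟨$⟩ʳ h)
    φ≡ h = trans (cong (φ ⟨$⟩ʳ_) (sym lem)) (σαφ≈id (σ ⟨$⟩ˡ (α ⟨$⟩ʳ h)))
      where
      lem : α ⟨$⟩ʳ (σ ⟨$⟩ʳ (σ ⟨$⟩ˡ (α ⟨$⟩ʳ h))) ≡ h
      lem = trans (cong (α ⟨$⟩ʳ_) (inverseʳ σ)) (α-involutive h)

    ασφ : ∀ h → α ⟨$⟩ʳ (σ ⟨$⟩ʳ (φ ⟨$⟩ʳ h)) ≡ h
    ασφ h = trans (cong (λ x → α ⟨$⟩ʳ (σ ⟨$⟩ʳ x)) (φ≡ h))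
                  (trans (cong (α ⟨$⟩ʳ_) (inverseʳ σ)) (α-involutive h))

  module _ {B : GroundSubset n} (adm : Admissible B) where
    private
      not-edge : ∀ {h} → InComplement B (halfEdge h) → B (inj₁ (edge h)) ≡ false
      not-edge {h} x with B (inj₁ (edge h)) in e
      ... | true  = ⊥-elim (x (onEdge e))
      ... | false = refl

      not-coedge : ∀ {h} → InComplement B (coHalfEdge h) → B (inj₁ (edge h)) ≡ true
      not-coedge {h} x with B (inj₁ (edge h)) in e
      ... | true  = refl
      ... | false = ⊥-elim (x (onCoedge (trans (adm (edge h)) (cong not e))))

      turn-edge : ∀ {h} → InComplement B (halfEdge h) → boundary B h ≡ σ ⟨$⟩ˡ h
      turn-edge x rewrite not-edge x = refl

      turn-coedge : ∀ {h} → InComplement B (coHalfEdge h) → boundary B h ≡ φ ⟨$⟩ʳ h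
      turn-coedge {h} x rewrite not-coedge x = sym (φ≡ h)

      no-crossing : ∀ h → ¬ InComplement B (crossing (edge h))
      no-crossing h x with B (inj₁ (edge h)) in e
      ... | true  = x (closed (crossing◁ h) (onEdge e))
      ... | false = x (closed (crossing◁* h) (onCoedge (trans (adm (edge h)) (cong not e))))

      along-σ : ∀ {g h} → InComplement B (vertex g) → SameCycle σ g h → g ∼[ B ] h
      along-σ x ε = ε
      along-σ {g} x (fwd refl ◅ p) =
        bwd (trans (turn-edge (x ∘ closed (vertex◁ (fwd refl ◅ ε)))) (inverseˡ σ)) ◅
        along-σ (λ { (closed (vertex◁ q) y) → x (closed (vertex◁ (fwd refl ◅ q)) y) }) p
      along-σ {g} x (bwd refl ◅ p) =
        fwd (trans (turn-edge (x ∘ closed (vertex◁ ε))) (inverseˡ σ)) ◅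
        along-σ (λ { (closed (vertex◁ q) y) → x (closed (vertex◁ (bwd refl ◅ q)) y) }) p

      along-φ : ∀ {g h} → InComplement B (covertex g) → SameCycle φ g h → g ∼[ B ] h
      along-φ x ε = ε
      along-φ {g} x (fwd refl ◅ p) =
        fwd (turn-coedge (x ∘ closed (covertex◁ ε))) ◅
        along-φ (λ { (closed (covertex◁ q) y) → x (closed (covertex◁ (fwd refl ◅ q)) y) }) p
      along-φ {g} x (bwd refl ◅ p) =
        bwd (turn-coedge (x ∘ closed (covertex◁ (bwd refl ◅ ε)))) ◅
        along-φ (λ { (closed (covertex◁ q) y) → x (closed (covertex◁ (bwd refl ◅ q)) y) }) p

      representative : Cell → HalfEdge
      representative (vertex h)     = h
      representative (covertex h)   = h
      representative (crossing j)   = proj₁ (edge-surjective j)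
      representative (halfEdge h)   = h
      representative (coHalfEdge h) = h
      representative (corner h)     = h

      ◁⇒∼ : ∀ {x y} → InComplement B x → InComplement B y → x ◁ y →
            representative x ∼[ B ] representative y
      ◁⇒∼ x∉ y∉ (vertex◁ p)    = along-σ x∉ p
      ◁⇒∼ x∉ y∉ (covertex◁ p)  = along-φ x∉ p
      ◁⇒∼ x∉ y∉ (crossing◁ h)  = ⊥-elim (no-crossing h x∉)
      ◁⇒∼ x∉ y∉ (crossing◁* h) = ⊥-elim (no-crossing h x∉)
      ◁⇒∼ x∉ y∉ (halfEdge◁ h)  = ε
      ◁⇒∼ x∉ y∉ (halfEdge-σ◁ h) = fwd (trans (turn-edge x∉) (inverseˡ σ)) ◅ ε
      ◁⇒∼ x∉ y∉ (coHalfEdge◁ h) = ε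
      ◁⇒∼ x∉ y∉ (coHalfEdge-σ◁ h) = fwd (trans (turn-coedge x∉) (σαφ≈id h)) ◅ ε

      corner∉ : ∀ h → InComplement B (corner h)
      corner∉ h (closed () _)

      Joined : Rel Cell 0ℓ
      Joined = EqClosure (λ u v → InComplement B u × InComplement B v × u ◁ v)

      joined-sym : ∀ {x y} → Joined x y → Joined y x
      joined-sym = Eq.symmetric (λ u v → InComplement B u × InComplement B v × u ◁ v)

      toCorner : ∀ x → InComplement B x → Joined x (corner (representative x))
      toCorner (vertex h) x∉ =
        fwd (x∉ , x∉ ∘ closed (vertex◁ ε) , vertex◁ ε) ◅
        fwd (x∉ ∘ closed (vertex◁ ε) , corner∉ h , halfEdge◁ h) ◅ ε
      toCorner (covertex h) x∉ =
        fwd (x∉ , x∉ ∘ closed (covertex◁ ε) , covertex◁ ε) ◅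
        fwd (x∉ ∘ closed (covertex◁ ε) , corner∉ h , coHalfEdge◁ h) ◅ ε
      toCorner (crossing j) x∉ with edge-surjective j
      ... | h , refl = ⊥-elim (no-crossing h x∉)
      toCorner (halfEdge h) x∉   = fwd (x∉ , corner∉ h , halfEdge◁ h) ◅ ε
      toCorner (coHalfEdge h) x∉ = fwd (x∉ , corner∉ h , coHalfEdge◁ h) ◅ ε
      toCorner (corner h) x∉     = ε

      step⇒Joined : ∀ h → Joined (corner h) (corner (boundary B h))
      step⇒Joined h with B (inj₁ (edge h)) in e
      ... | true  = subst (λ g → Joined (corner h) (corner g)) (φ≡ h)
        (bwd (x∉ , corner∉ h , coHalfEdge◁ h) ◅ fwd (x∉ , corner∉ _ , incident) ◅ ε)
        where
        x∉ : InComplement B (coHalfEdge h)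
        x∉ (onCoedge e*) = false≢true (trans (sym (trans (adm (edge h)) (cong not e))) e*)
        x∉ (closed (coHalfEdge◁ _) y)   = corner∉ _ y
        x∉ (closed (coHalfEdge-σ◁ _) y) = corner∉ _ y
        incident : coHalfEdge h ◁ corner (φ ⟨$⟩ʳ h)
        incident = subst (λ g → coHalfEdge g ◁ corner (φ ⟨$⟩ʳ h)) (ασφ h) (coHalfEdge-σ◁ (φ ⟨$⟩ʳ h))
      ... | false = bwd (x∉ , corner∉ h , halfEdge◁ h) ◅ fwd (x∉ , corner∉ _ , incident) ◅ ε
        where
        x∉ : InComplement B (halfEdge h)
        x∉ (onEdge e′) = false≢true (trans (sym e) e′)
        x∉ (closed (halfEdge◁ _) y)   = corner∉ _ y
        x∉ (closed (halfEdge-σ◁ _) y) = corner∉ _ y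
        incident : halfEdge h ◁ corner (σ ⟨$⟩ˡ h)
        incident = subst (λ g → halfEdge g ◁ corner (σ ⟨$⟩ˡ h)) (inverseʳ σ) (halfEdge-σ◁ (σ ⟨$⟩ˡ h))

    connected⇒singleCycle : ComplementConnected B → SingleCycle B
    connected⇒singleCycle conn g h = go (conn (corner∉ g) (corner∉ h))
      where
      go : ∀ {x y} → Joined x y → representative x ∼[ B ] representative y
      go ε = ε
      go (fwd (x∉ , y∉ , i) ◅ p) = ◁⇒∼ x∉ y∉ i ◅◅ go p
      go (bwd (x∉ , y∉ , i) ◅ p) = ∼-sym {B} (◁⇒∼ x∉ y∉ i) ◅◅ go p

    singleCycle⇒connected : SingleCycle B → ComplementConnected B
    singleCycle⇒connected sc {x} {y} x∉ y∉ =
      toCorner x x∉ ◅◅ go (sc (representative x) (representative y)) ◅◅ joined-sym (toCorner y y∉)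
      where
      go : ∀ {g h} → g ∼[ B ] h → Joined (corner g) (corner h)
      go ε = ε
      go (fwd refl ◅ p) = step⇒Joined _ ◅◅ go p
      go (bwd refl ◅ p) = joined-sym (step⇒Joined _) ◅◅ go p

module Exchange {n : ℕ} (M : Map n) where
  open Map M
  open Surface M
  open Boundary M

  private
    half : Fin n → HalfEdge
    half j = proj₁ (edge-surjective j)

    edge-half : ∀ j → edge (half j) ≡ j
    edge-half j = proj₂ (edge-surjective j)

    α! : ∀ h → α ⟨$⟩ʳ (α ⟨$⟩ʳ h) ≡ h
    α! = α-involutive

    turn-involutive : ∀ B h → turn B (turn B h) ≡ h
    turn-involutive B h with B (inj₁ (edge h)) in e
    ... | true  rewrite edge-α h | e = α! h
    ... | false rewrite e = refl

    boundary-injective : ∀ B {g h} → boundary B g ≡ boundary B h → g ≡ h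
    boundary-injective B {g} {h} eq = begin
      g                   ≡⟨ turn-involutive B g ⟨
      turn B (turn B g)   ≡⟨ cong (turn B) turn≡ ⟩
      turn B (turn B h)   ≡⟨ turn-involutive B h ⟩
      h                   ∎
      where
      open ≡-Reasoning
      turn≡ : turn B g ≡ turn B h
      turn≡ = trans (sym (inverseʳ σ)) (trans (cong (σ ⟨$⟩ʳ_) eq) (inverseʳ σ))

    -- B △ {j, j*}
    flip : Fin n → GroundSubset n → GroundSubset n
    flip j B x = B x xor does (index x ≟ j)

    boundary-cong : ∀ {B C} h → B (inj₁ (edge h)) ≡ C (inj₁ (edge h)) → boundary B h ≡ boundary C h
    boundary-cong h eq rewrite eq = refl

    boundary-flip-≢ : ∀ {B} j h → edge h ≢ j → boundary (flip j B) h ≡ boundary B h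
    boundary-flip-≢ {B} j h ≢ rewrite dec-false (edge h ≟ j) ≢ with B (inj₁ (edge h))
    ... | true  = refl
    ... | false = refl

    boundary-complement : ∀ {B C} h → C (inj₁ (edge h)) ≡ not (B (inj₁ (edge h))) →
                          boundary C h ≡ boundary B (α ⟨$⟩ʳ h)
    boundary-complement {B} h eq rewrite edge-α h | eq with B (inj₁ (edge h))
    ... | true  rewrite α! h = refl
    ... | false = refl

    boundary-flip-≡ : ∀ {B} j h → edge h ≡ j → boundary (flip j B) h ≡ boundary B (α ⟨$⟩ʳ h)
    boundary-flip-≡ {B} j h e = boundary-complement {B} {flip j B} h lem
      where
      lem : flip j B (inj₁ (edge h)) ≡ not (B (inj₁ (edge h)))
      lem rewrite dec-true (edge h ≟ j) e with B (inj₁ (edge h))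
      ... | true  = refl
      ... | false = refl

    module Iterate (B : GroundSubset n) where
      private f = boundary B

      f^ : ℕ → HalfEdge → HalfEdge
      f^ zero    x = x
      f^ (suc k) x = f^ k (f x)

      f^-+ : ∀ k l x → f^ (k ℕ.+ l) x ≡ f^ l (f^ k x)
      f^-+ zero    l x = refl
      f^-+ (suc k) l x = f^-+ k l (f x)

      f^-injective : ∀ k {x y} → f^ k x ≡ f^ k y → x ≡ y
      f^-injective zero    e = e
      f^-injective (suc k) e = boundary-injective B (f^-injective k e)

      f^⇒∼ : ∀ k x → x ∼[ B ] f^ k x
      f^⇒∼ zero    x = ε
      f^⇒∼ (suc k) x = fwd refl ◅ f^⇒∼ k (f x)

      period : ∀ x → ∃[ m ] (m ℕ.< 2 ℕ.* n) × f^ (suc m) x ≡ x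
      period x with pigeonhole (ℕₚ.n<1+n (2 ℕ.* n)) (λ k → f^ (toℕ k) x)
      ... | i , j , i<j , eq with ℕₚ.m≤n⇒∃[o]m+o≡n i<j
      ...   | m , e = m , m< , sym (f^-injective (toℕ i) (begin
        f^ (toℕ i) x                 ≡⟨ eq ⟩
        f^ (toℕ j) x                 ≡⟨ cong (λ k → f^ k x) (trans (sym e) (ℕₚ.+-comm (suc (toℕ i)) m)) ⟩
        f^ (m ℕ.+ suc (toℕ i)) x     ≡⟨ cong (λ k → f^ k x) (ℕₚ.+-suc m (toℕ i)) ⟩
        f^ (suc m ℕ.+ toℕ i) x       ≡⟨ f^-+ (suc m) (toℕ i) x ⟩
        f^ (toℕ i) (f^ (suc m) x)    ∎))
        where
        open ≡-Reasoning
        m< : m ℕ.< 2 ℕ.* n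
        m< = ℕₚ.≤-trans (s≤s (ℕₚ.m≤n+m m (toℕ i)))
               (subst (ℕ._≤ 2 ℕ.* n) (sym e) (ℕₚ.≤-pred (toℕ<n j)))

      Reach : Rel HalfEdge 0ℓ
      Reach x y = ∃[ k ] f^ k x ≡ y

      ∼⇒Reach : ∀ {x y} → x ∼[ B ] y → Reach x y
      ∼⇒Reach ε = 0 , refl
      ∼⇒Reach (fwd refl ◅ p) with ∼⇒Reach p
      ... | k , e = suc k , e
      ∼⇒Reach {x} (_◅_ {j = z} (bwd fz≡x) p) with period z | ∼⇒Reach p
      ... | m , _ , e | k , e′ = m ℕ.+ k ,
        trans (f^-+ m k x) (trans (cong (λ y → f^ k (f^ m y)) (sym fz≡x)) (trans (cong (f^ k) e) e′))

      f^-multiple : ∀ q m x → f^ m x ≡ x → f^ (q ℕ.* m) x ≡ x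
      f^-multiple zero    m x e = refl
      f^-multiple (suc q) m x e =
        trans (f^-+ m (q ℕ.* m) x) (trans (cong (f^ (q ℕ.* m)) e) (f^-multiple q m x e))

      bounded : ∀ {x y} → Reach x y → ∃[ k ] f^ (toℕ {2 ℕ.* n} k) x ≡ y
      bounded {x} {y} (k , e) with period x
      ... | m , m< , p = fromℕ< r< , (begin
        f^ (toℕ (fromℕ< r<)) x         ≡⟨ cong (λ l → f^ l x) (toℕ-fromℕ< r<) ⟩
        f^ r x                         ≡⟨ cong (f^ r) (f^-multiple q (suc m) x p) ⟨
        f^ r (f^ (q ℕ.* suc m) x)      ≡⟨ f^-+ (q ℕ.* suc m) r x ⟨
        f^ (q ℕ.* suc m ℕ.+ r) x       ≡⟨ cong (λ l → f^ l x) (trans (ℕₚ.+-comm _ r) (sym (ℕ÷.m≡m%n+[m/n]*n k (suc m)))) ⟩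
        f^ k x                         ≡⟨ e ⟩
        y                              ∎)
        where
        open ≡-Reasoning
        q = k ℕ÷./ suc m
        r = k ℕ÷.% suc m
        r< : r ℕ.< 2 ℕ.* n
        r< = ℕₚ.<-≤-trans (ℕ÷.m%n<n k (suc m)) m<

      _∼?_ : ∀ x y → Dec (x ∼[ B ] y)
      x ∼? y = map′ (λ { (k , e) → subst (x ∼[ B ]_) e (f^⇒∼ (toℕ k) x) })
                    (bounded ∘ ∼⇒Reach)
                    (any? λ k → f^ (toℕ k) x ≟ y)

    open Iterate using (f^; _∼?_; ∼⇒Reach)

    same-edge : ∀ {h} j → edge h ≡ j → h ≡ half j ⊎ h ≡ α ⟨$⟩ʳ half j
    same-edge {h} j e = edge-injective h (half j) (trans e (sym (edge-half j)))

    other-end : ∀ {C} j {h} → half j ∼[ C ] (α ⟨$⟩ʳ half j) → edge h ≡ j → h ∼[ C ] (α ⟨$⟩ʳ h)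
    other-end {C} j p e with same-edge j e
    ... | inj₁ refl = p
    ... | inj₂ refl rewrite α! (half j) = ∼-sym {C} p

    -- Exchanging the values at the two ends of an edge joins two cycles.
    merge : ∀ {B} j → ¬ (half j ∼[ B ] (α ⟨$⟩ʳ half j)) → half j ∼[ flip j B ] (α ⟨$⟩ʳ half j)
    merge {B} j ≁ with ∼⇒Reach B (bwd refl ◅ ε)
    ... | k , e = fwd (boundary-flip-≡ {B} j p (edge-half j)) ◅ walk k (boundary B q) (bwd refl ◅ ε) e
      where
      p = half j
      q = α ⟨$⟩ʳ half j
      walk : ∀ k x → x ∼[ B ] q → f^ B k x ≡ q → x ∼[ flip j B ] q
      walk zero    x _ refl = ε
      walk (suc k) x x∼q e with edge x ≟ j
      ... | no ≢ = fwd (boundary-flip-≢ {B} j x ≢) ◅ walk k (boundary B x) (bwd refl ◅ x∼q) e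
      ... | yes ≡j with same-edge j ≡j
      ...   | inj₁ refl = ⊥-elim (≁ x∼q)
      ...   | inj₂ refl = ε

    coarser : ∀ {B} j → half j ∼[ flip j B ] (α ⟨$⟩ʳ half j) → ∀ {x y} → x ∼[ B ] y → x ∼[ flip j B ] y
    coarser {B} j p = closure-map λ { {x} refl → step x }
      where
      step : ∀ x → x ∼[ flip j B ] boundary B x
      step x with edge x ≟ j
      ... | no ≢   = fwd (boundary-flip-≢ {B} j x ≢) ◅ ε
      ... | yes ≡j = other-end {flip j B} j p ≡j ◅◅
        fwd (trans (boundary-flip-≡ {B} j _ (trans (edge-α x) ≡j)) (cong (boundary B) (α! x))) ◅ ε

    -- Exchanging the values at the two ends of an edge splits a single cycle
    -- into at most two.
    split : ∀ {B} j → SingleCycle B → ∀ h →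
            h ∼[ flip j B ] half j ⊎ h ∼[ flip j B ] (α ⟨$⟩ʳ half j)
    split {B} j sc h = go (sc h (half j))
      where
      C = flip j B
      P : HalfEdge → Set
      P h = h ∼[ C ] half j ⊎ h ∼[ C ] (α ⟨$⟩ʳ half j)
      at : ∀ {x} → edge x ≡ j → P x
      at e with same-edge j e
      ... | inj₁ refl = inj₁ ε
      ... | inj₂ refl = inj₂ ε
      at′ : ∀ {x} → edge x ≡ j → P (boundary B x)
      at′ {x} e = Sum.map (b ◅_) (b ◅_) (at (trans (edge-α x) e))
        where b = bwd (trans (boundary-flip-≡ {B} j _ (trans (edge-α x) e)) (cong (boundary B) (α! x)))
      go : ∀ {x} → x ∼[ B ] half j → P x
      go ε = inj₁ ε
      go {x} (fwd refl ◅ p) with edge x ≟ j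
      ... | yes e = at e
      ... | no ≢  = Sum.map (fwd (boundary-flip-≢ {B} j x ≢) ◅_) (fwd (boundary-flip-≢ {B} j x ≢) ◅_) (go p)
      go (_◅_ {j = z} (bwd refl) p) with edge z ≟ j
      ... | yes e = at′ e
      ... | no ≢  = Sum.map (bwd (boundary-flip-≢ {B} j z ≢) ◅_) (bwd (boundary-flip-≢ {B} j z ≢) ◅_) (go p)

    ∼-cong : ∀ {B C} → (∀ i → B (inj₁ i) ≡ C (inj₁ i)) → ∀ {g h} → g ∼[ B ] h → g ∼[ C ] h
    ∼-cong {B} {C} eq = closure-map λ { {x} refl → fwd (sym (boundary-cong {B} {C} x (eq (edge x)))) ◅ ε }

    through : ∀ {B} j → SingleCycle B → half j ∼[ flip j B ] (α ⟨$⟩ʳ half j) → SingleCycle (flip j B)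
    through {B} j sc p g h = coarser {B} j p (sc g h)

    rejoin : ∀ {B} j k → SingleCycle B → ¬ (half k ∼[ flip j B ] (α ⟨$⟩ʳ half k)) →
             SingleCycle (flip k (flip j B))
    rejoin {B} j k sc ≁ g h = all g ◅◅ ∼-sym {D} (all h)
      where
      C = flip j B
      D = flip k C
      k∼ : half k ∼[ D ] (α ⟨$⟩ʳ half k)
      k∼ = merge {C} k ≁
      up : ∀ {x y} → x ∼[ C ] y → x ∼[ D ] y
      up = coarser {C} k k∼
      ends : half j ∼[ D ] (α ⟨$⟩ʳ half j)
      ends with split {B} j sc (half k) | split {B} j sc (α ⟨$⟩ʳ half k)
      ... | inj₁ a | inj₁ b = ⊥-elim (≁ (a ◅◅ ∼-sym {C} b))
      ... | inj₂ a | inj₂ b = ⊥-elim (≁ (a ◅◅ ∼-sym {C} b))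
      ... | inj₁ a | inj₂ b = up (∼-sym {C} a) ◅◅ k∼ ◅◅ up b
      ... | inj₂ a | inj₁ b = up (∼-sym {C} b) ◅◅ ∼-sym {D} k∼ ◅◅ up a
      all : ∀ x → x ∼[ D ] half j
      all x with split {B} j sc x
      ... | inj₁ a = up a
      ... | inj₂ a = up a ◅◅ ∼-sym {D} ends

    ≢⇒not : ∀ a b → a ≢ b → a ≡ not b
    ≢⇒not true  true  ne = ⊥-elim (ne refl)
    ≢⇒not true  false _  = refl
    ≢⇒not false true  _  = refl
    ≢⇒not false false ne = ⊥-elim (ne refl)

    xor≡true : ∀ a b → (a xor b) ≡ true → b ≡ not a
    xor≡true true  false _ = refl
    xor≡true false true  _ = refl

    search : ∀ {B₁ B₂} j → SingleCycle B₁ → SingleCycle B₂ → B₂ (inj₁ j) ≡ not (B₁ (inj₁ j)) →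
             SingleCycle (flip j B₁) ⊎
             ∃[ k ] k ≢ j × B₂ (inj₁ k) ≡ not (B₁ (inj₁ k)) × SingleCycle (flip k (flip j B₁))
    search {B₁} {B₂} j sc₁ sc₂ dj with _∼?_ (flip j B₁) (half j) (α ⟨$⟩ʳ half j)
    ... | yes p = inj₁ (through {B₁} j sc₁ p)
    ... | no ≁ with any? (λ k → ¬? (k ≟ j) ×-dec (B₂ (inj₁ k) ≟ᵇ not (B₁ (inj₁ k))) ×-dec
                                ¬? (_∼?_ (flip j B₁) (half k) (α ⟨$⟩ʳ half k)))
    ...   | yes (k , k≢j , dk , ≁k) = inj₂ (k , k≢j , dk , rejoin {B₁} j k sc₁ ≁k)
    ...   | no none = ⊥-elim (≁ (closure-map (λ { {x} refl → step x }) (sc₂ _ _)))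
      where
      C = flip j B₁
      xor-true : ∀ b → b xor true ≡ not b
      xor-true true  = refl
      xor-true false = refl
      C≡B₁ : ∀ {i} → i ≢ j → C (inj₁ i) ≡ B₁ (inj₁ i)
      C≡B₁ {i} i≢j = trans (cong (B₁ (inj₁ i) xor_) (dec-false (i ≟ j) i≢j)) (xor-identityʳ _)
      C≡not : ∀ {i} → i ≡ j → C (inj₁ i) ≡ not (B₁ (inj₁ i))
      C≡not {i} i≡j = trans (cong (B₁ (inj₁ i) xor_) (dec-true (i ≟ j) i≡j)) (xor-true _)
      differ : ∀ x → B₂ (inj₁ (edge x)) ≡ not (C (inj₁ (edge x))) →
               Dec (edge x ≡ j) → Dec (half (edge x) ∼[ C ] (α ⟨$⟩ʳ half (edge x))) →
               x ∼[ C ] boundary B₂ x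
      differ x ne (yes e) _ =
        ⊥-elim (b≢not-b _ (trans (sym (subst (λ i → B₂ (inj₁ i) ≡ not (B₁ (inj₁ i))) (sym e) dj))
                                 (trans ne (cong not (C≡not e)))))
        where
        b≢not-b : ∀ b → ¬ (b ≡ not b)
        b≢not-b true  ()
        b≢not-b false ()
      differ x ne (no x≢j) (no ≁x) =
        ⊥-elim (none (edge x , x≢j , trans ne (cong not (C≡B₁ x≢j)) , ≁x))
      differ x ne (no x≢j) (yes p) =
        other-end {C} (edge x) p refl ◅◅ fwd (sym (boundary-complement {C} {B₂} x ne)) ◅ ε
      step : ∀ x → x ∼[ C ] boundary B₂ x
      step x with B₂ (inj₁ (edge x)) ≟ᵇ C (inj₁ (edge x))
      ... | yes e = fwd (sym (boundary-cong {B₂} {C} x e)) ◅ ε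
      ... | no ne = differ x (≢⇒not _ _ ne) (edge x ≟ j) (_∼?_ C (half (edge x)) (α ⟨$⟩ʳ half (edge x)))

    pairs-inj₁ : ∀ (e f : Ground n) i → pairs e f (inj₁ i) ≡ does (i ≟ index e) ∨ does (i ≟ index f)
    pairs-inj₁ (inj₁ j) (inj₁ k) i = cong (does (i ≟ j) ∨_) (∨-identityʳ _)
    pairs-inj₁ (inj₁ j) (inj₂ k) i = refl
    pairs-inj₁ (inj₂ j) (inj₁ k) i = trans (cong (does (i ≟ k) ∨_) (∨-identityʳ _)) (∨-comm (does (i ≟ k)) _)
    pairs-inj₁ (inj₂ j) (inj₂ k) i = refl

    pairs-* : ∀ (e f : Ground n) i → pairs e f (inj₂ i) ≡ pairs e f (inj₁ i)
    pairs-* e f i = trans (swapped e f) (sym (pairs-inj₁ e f i))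
      where
      swapped : ∀ e f → pairs e f (inj₂ i) ≡ does (i ≟ index e) ∨ does (i ≟ index f)
      swapped (inj₁ j) (inj₁ k) = refl
      swapped (inj₁ j) (inj₂ k) = trans (cong (does (i ≟ k) ∨_) (∨-identityʳ _)) (∨-comm (does (i ≟ k)) _)
      swapped (inj₂ j) (inj₁ k) = refl
      swapped (inj₂ j) (inj₂ k) = cong (does (i ≟ j) ∨_) (∨-identityʳ _)

    admissible-△ : ∀ {B} (e f : Ground n) → Admissible B → Admissible (B △ pairs e f)
    admissible-△ {B} e f adm i rewrite adm i | pairs-* e f i =
      sym (not-distribˡ-xor (B (inj₁ i)) (pairs e f (inj₁ i)))

    difference : ∀ {B C} → Admissible B → Admissible C → ∀ (e : Ground n) → e ∈ᴳ (B △ C) →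
                 C (inj₁ (index e)) ≡ not (B (inj₁ (index e)))
    difference {B} {C} _ _ (inj₁ j) d = xor≡true _ _ d
    difference {B} {C} b c (inj₂ j) d rewrite b j | c j =
      trans (sym (not-involutive _)) (trans (cong not (xor≡true _ _ d)) (cong not (not-involutive _)))

    flip-one : ∀ B (e : Ground n) i → flip (index e) B (inj₁ i) ≡ (B △ pairs e e) (inj₁ i)
    flip-one B e i = cong (B (inj₁ i) xor_)
      (trans (sym (∨-idem _)) (sym (pairs-inj₁ e e i)))

    flip-two : ∀ B (e : Ground n) k → k ≢ index e → ∀ i →
               flip k (flip (index e) B) (inj₁ i) ≡ (B △ pairs e (inj₁ k)) (inj₁ i)
    flip-two B e k k≢ i = trans (xor-assoc (B (inj₁ i)) _ _)
      (cong (B (inj₁ i) xor_) (trans disjoint (sym (pairs-inj₁ e (inj₁ k) i))))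
      where
      disjoint : does (i ≟ index e) xor does (i ≟ k) ≡ does (i ≟ index e) ∨ does (i ≟ k)
      disjoint with i ≟ index e
      ... | yes refl rewrite dec-false (i ≟ k) (k≢ ∘ sym) = refl
      ... | no _ = refl

    singleCycle-cong : ∀ {B C} → (∀ i → B (inj₁ i) ≡ C (inj₁ i)) → SingleCycle B → SingleCycle C
    singleCycle-cong {B} {C} eq sc g h = ∼-cong {B} {C} eq (sc g h)

  exchange : ∀ B₁ B₂ → Base B₁ → Base B₂ → ∀ j → j ∈ᴳ (B₁ △ B₂) →
             ∃[ k ] (k ∈ᴳ (B₂ △ B₁)) × Base (B₁ △ pairs j k)
  exchange B₁ B₂ (a₁ , c₁) (a₂ , c₂) e e∈
    with search {B₁} {B₂} (index e) (connected⇒singleCycle a₁ c₁) (connected⇒singleCycle a₂ c₂)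
                (difference {B₁} {B₂} a₁ a₂ e e∈)
  ... | inj₁ sc = e , trans (xor-comm (B₂ e) (B₁ e)) e∈ , a ,
    singleCycle⇒connected a (singleCycle-cong {flip (index e) B₁} {B₁ △ pairs e e} (flip-one B₁ e) sc)
    where
    a : Admissible (B₁ △ pairs e e)
    a = admissible-△ {B₁} e e a₁
  ... | inj₂ (k , k≢ , dk , sc) = inj₁ k , k∈ , a ,
    singleCycle⇒connected a (singleCycle-cong {flip k (flip (index e) B₁)} {B₁ △ pairs e (inj₁ k)}
      (flip-two B₁ e k k≢) sc)
    where
    a : Admissible (B₁ △ pairs e (inj₁ k))
    a = admissible-△ {B₁} e (inj₁ k) a₁
    k∈ : B₂ (inj₁ k) xor B₁ (inj₁ k) ≡ true
    k∈ rewrite dk with B₁ (inj₁ k)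
    ... | true  = refl
    ... | false = refl

Δ : ∀ {n} → Map n → LagrangianMatroid n
Δ M = record
  { IsBase     = Surface.Base M
  ; admissible = λ _ → proj₁
  ; exchange   = Exchange.exchange M
  }

-- Non-zero is read as apart from zero, i.e. as invertible; for a field with
-- decidable equality this is the same as being different from zero.
module LinearAlgebra {a ℓ₁ ℓ₂} (𝔽 : HeytingField a ℓ₁ ℓ₂) where
  open HeytingField 𝔽 using (_#_; _+_; _*_; -_; 0#; 1#; heytingCommutativeRing)
    renaming (Carrier to F; _≈_ to _≈ᶠ_)

  private
    commutativeRing : CommutativeRing a ℓ₁
    commutativeRing = HeytingCommutativeRing.commutativeRing heytingCommutativeRing

  open MonoidSum (CommutativeRing.+-monoid commutativeRing) using (sum-syntax)
  open MonoidMult (CommutativeRing.+-monoid commutativeRing) using () renaming (_×_ to _·_)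
  open SemiringExp (CommutativeRing.semiring commutativeRing) using (_^_)

  CharacteristicZero : Set ℓ₂
  CharacteristicZero = ∀ m .{{_ : NonZero m}} → (m · 1#) # 0#

  Matrix : Set → Set → Set a
  Matrix I J = I → J → F

  module _ {J : Set} {r : ℕ} (v : Matrix (Fin r) J) where

    combination : (Fin r → F) → J → F
    combination t j = ∑[ i < r ] (t i * v i j)

    LinearlyIndependent : Set (a ⊔ ℓ₁)
    LinearlyIndependent = ∀ t → (∀ j → combination t j ≈ᶠ 0#) → ∀ i → t i ≈ᶠ 0#

    InSpan : (J → F) → Set (a ⊔ ℓ₁)
    InSpan w = ∃[ t ] (∀ j → w j ≈ᶠ combination t j)

  -- The row space of P has a basis of r vectors.
  HasRank : ∀ {m} {J : Set} → Matrix (Fin m) J → ℕ → Set (a ⊔ ℓ₁)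
  HasRank {J = J} P r = Σ (Matrix (Fin r) J) λ v →
    LinearlyIndependent v × (∀ i → InSpan P (v i)) × (∀ i → InSpan v (P i))

  -- Laplace expansion along the first row.
  det : ∀ {m} → Matrix (Fin m) (Fin m) → F
  det {zero}  P = 1#
  det {suc m} P =
    ∑[ j < suc m ] ((- 1#) ^ toℕ j * P zero j * det (λ i k → P (suc i) (punchIn j k)))

  _⊗_ᵗ : ∀ {m} → Matrix (Fin m) (Fin m) → Matrix (Fin m) (Fin m) → Matrix (Fin m) (Fin m)
  _⊗_ᵗ {m} X Y i k = ∑[ j < m ] (X i j * Y k j)

  Antisymmetric : ∀ {m} → Matrix (Fin m) (Fin m) → Set ℓ₁
  Antisymmetric P = ∀ i k → P i k ≈ᶠ - P k i

  -- The n × 2n matrix (X|Y).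
  BlockMatrix : ℕ → Set a
  BlockMatrix n = Matrix (Fin n) (Ground n)

  left right : ∀ {n} → BlockMatrix n → Matrix (Fin n) (Fin n)
  left  P i j = P i (inj₁ j)
  right P i j = P i (inj₂ j)

  -- For admissible B, column j of the minor is the column of P labelled by
  -- the member of {j, j*} in B; reordering the columns changes only the sign.
  minor : ∀ {n} → BlockMatrix n → GroundSubset n → F
  minor P B = det (λ i j → P i (if B (inj₁ j) then inj₁ j else inj₂ j))

  record IsRepresentation {n} (P : BlockMatrix n) (L : LagrangianMatroid n) : Set (a ⊔ ℓ₁ ⊔ ℓ₂) where
    open LagrangianMatroid L
    field
      rank          : HasRank P n
      antisymmetric : Antisymmetric (left P ⊗ right P ᵗ)
      bases         : ∀ B → Admissible B → IsBase B ⇔ (minor P B # 0#)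

  interchange : ∀ {n} → Subset n → BlockMatrix n → BlockMatrix n
  interchange A P i x = P i (if does (index x ∈? A) then x * else x)

{-# OPTIONS --safe #-}

-- Put B′ = {x : swap x ∈ B}, where swap interchanges j and j* for j ∈ A.  The
-- columns of the interchanged matrix selected by B are the columns of (X|Y)
-- selected by B′, in the same order, so the two minors are equal.  The boundary
-- permutation of B in ∂_A M sends h to σ⁻¹ (c_A (turn B h)), and c_A undoes or
-- supplies the turn by α exactly on the edges in A; so it is the boundary
-- permutation of B′ in M, and B is a base of ∂_A M iff B′ is a base of M.

module Submission where

open import Defs
open import Algebra.Apartness.Bundles using (HeytingField; HeytingCommutativeRing)
open import Algebra.Bundles using (CommutativeRing)
import Algebra.Properties.CommutativeMonoid.Sum as CommutativeMonoidSum
import Algebra.Properties.Group as GroupProperties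
import Algebra.Properties.Semiring.Exp as SemiringExp
open import Data.Bool.Base using (true; false; not; if_then_else_)
open import Data.Bool.Properties using (not-involutive)
open import Data.Fin.Base using (Fin; zero; suc; toℕ; punchIn)
open import Data.Fin.Permutation using (_⟨$⟩ʳ_; _⟨$⟩ˡ_; inverseˡ)
open import Data.Fin.Subset using (Subset)
open import Data.Fin.Subset.Properties using (_∈?_)
open import Data.List.Base using (filter; allFin)
open import Data.List.Membership.Propositional.Properties using (∈-filter⁺; ∈-filter⁻; ∈-allFin)
open import Data.List.Relation.Unary.Unique.Propositional.Properties using (filter⁺; allFin⁺)
open import Data.Nat.Base using (ℕ; zero; suc)
open import Data.Product.Base using (_,_; proj₂)
open import Data.Sum.Base using (inj₁; inj₂)
open import Function.Base using (_∘_)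
open import Function.Bundles using (_⇔_; mk⇔)
open import Function.Construct.Composition using (_⇔-∘_)
import Relation.Binary.Construct.Closure.Equivalence as Eq
open import Relation.Binary.PropositionalEquality using (_≡_; refl; sym; trans; cong; cong₂; subst)
import Relation.Binary.Reasoning.Setoid as SetoidReasoning
open import Relation.Nullary using (does)
open import Relation.Nullary.Decidable using (dec-true; dec-false)

module _ {n : ℕ} (A : Subset n) where

  swap : Ground n → Ground n
  swap x = if does (index x ∈? A) then x * else x

  swap-involutive : ∀ x → swap (swap x) ≡ x
  swap-involutive (inj₁ j) with does (j ∈? A) in e
  ... | true  rewrite e = refl
  ... | false rewrite e = refl
  swap-involutive (inj₂ j) with does (j ∈? A) in e
  ... | true  rewrite e = refl
  ... | false rewrite e = refl

  admissible-swap : ∀ B → Admissible B → Admissible (B ∘ swap)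
  admissible-swap B adm j with does (j ∈? A)
  ... | true  = trans (sym (not-involutive (B (inj₁ j)))) (cong not (sym (adm j)))
  ... | false = adm j

  -- For `j` in `A` the outer `swap` exchanges the two possible columns, while the test on the right
  -- reads `B` at `j*`, which admissibility makes the negation of the test on the left.
  swap-select : ∀ B → Admissible B → ∀ j →
    swap (if B (inj₁ j) then inj₁ j else inj₂ j) ≡
    (if B (swap (inj₁ j)) then inj₁ j else inj₂ j)
  swap-select B adm j with B (inj₁ j) in e | does (j ∈? A) in d
  ... | true  | true  rewrite d | adm j | e = refl
  ... | true  | false rewrite d | e = refl
  ... | false | true  rewrite d | adm j | e = refl
  ... | false | false rewrite d | e = refl

module _ {n : ℕ} (M : Map n) (A : Subset n) where
  open Map M
  open Boundary using (turn; boundary; connected⇒singleCycle; singleCycle⇒connected)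
  open Surface using (Base)

  turnOn : HalfEdge → HalfEdge
  turnOn h = if does (edge h ∈? A) then α ⟨$⟩ʳ h else h

  turnOn-involutive : ∀ h → turnOn (turnOn h) ≡ h
  turnOn-involutive h with does (edge h ∈? A) in e
  ... | true  rewrite edge-α h | e = α-involutive h
  ... | false rewrite e = refl

  -- The transpositions have disjoint supports, so at most one factor moves `h`. Testing `A`
  -- directly, instead of a filtered list, lets the same case split govern `turnOn` and `swap`.
  c≡turnOn : ∀ h → c[ A ] ⟨$⟩ʳ h ≡ turnOn h
  c≡turnOn h with productOf-cases M (filter (_∈? A) (allFin n)) (filter⁺ (_∈? A) (allFin⁺ n)) h
  ... | inj₁ (e , h∉) rewrite dec-false (edge h ∈? A) (h∉ ∘ ∈-filter⁺ (_∈? A) (∈-allFin (edge h))) = e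
  ... | inj₂ (e , h∈) rewrite dec-true (edge h ∈? A) (proj₂ (∈-filter⁻ (_∈? A) {xs = allFin n} h∈)) = e

  c⁻¹≡turnOn : ∀ h → c[ A ] ⟨$⟩ˡ h ≡ turnOn h
  c⁻¹≡turnOn h = trans
    -- Write `h` as the image under `c[ A ]` of `turnOn h`, then cancel.
    (cong (c[ A ] ⟨$⟩ˡ_) (trans (sym (turnOn-involutive h)) (sym (c≡turnOn (turnOn h)))))
    (inverseˡ c[ A ])

  turnOn-turn : ∀ B → Admissible B → ∀ h → turnOn (turn M B h) ≡ turn M (B ∘ swap A) h
  turnOn-turn B adm h with B (inj₁ (edge h)) in b | does (edge h ∈? A) in d
  ... | true  | true  rewrite edge-α h | d | adm (edge h) | b = α-involutive h
  ... | true  | false rewrite edge-α h | d | b = refl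
  ... | false | true  rewrite d | adm (edge h) | b = refl
  ... | false | false rewrite d | b = refl

  boundary-∂ : ∀ B → Admissible B → ∀ h → boundary (∂ M A) B h ≡ boundary M (B ∘ swap A) h
  -- The inverse of `σ ∘ₚ c[ A ]` applies the inverse of `c[ A ]` first, and `∂` keeps `α` and
  -- `edge`, so `turn` is the same function for both maps.
  boundary-∂ B adm h = cong (σ ⟨$⟩ˡ_)
    (trans (c⁻¹≡turnOn (turn M B h)) (turnOn-turn B adm h))

  -- The cells of the two surfaces are never compared: each direction passes through the
  -- single-cycle criterion, where equal boundary functions generate the same orbits.
  base-∂ : ∀ B → Admissible B → Base (∂ M A) B ⇔ Base M (B ∘ swap A)
  base-∂ B adm = mk⇔
    (λ { (_ , conn) → adm′ , singleCycle⇒connected M adm′ λ g h →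
      Eq.map (trans (sym (boundary-∂ B adm _))) (connected⇒singleCycle (∂ M A) adm conn g h) })
    (λ { (_ , conn) → adm , singleCycle⇒connected (∂ M A) adm λ g h →
      Eq.map (trans (boundary-∂ B adm _)) (connected⇒singleCycle M adm′ conn g h) })
    where
    adm′ : Admissible (B ∘ swap A)
    adm′ = admissible-swap A B adm

module _ {a ℓ₁ ℓ₂} (𝔽 : HeytingField a ℓ₁ ℓ₂) where
  open LinearAlgebra 𝔽
  open HeytingField 𝔽 using (_+_; _*_; -_; 0#; 1#; heytingCommutativeRing)
    renaming (Carrier to F; _≈_ to _≈ᶠ_)
  private
    ring : CommutativeRing a ℓ₁
    ring = HeytingCommutativeRing.commutativeRing heytingCommutativeRing
    module R = CommutativeRing ring
  open CommutativeMonoidSum R.+-commutativeMonoid using (sum; sum-cong-≗; sum-cong-≋; ∑-distrib-+)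
  open SemiringExp R.semiring using (_^_)
  open GroupProperties R.+-group using (inverseˡ-unique)
  open SetoidReasoning R.setoid

  -- Kept propositional rather than up to `_≈ᶠ_`, so that a statement about a minor can be
  -- transported by `subst`.
  det-cong : ∀ {m} {P Q : Matrix (Fin m) (Fin m)} → (∀ i j → P i j ≡ Q i j) → det P ≡ det Q
  det-cong {zero}  eq = refl
  det-cong {suc m} eq = sum-cong-≗ λ j →
    cong₂ _*_ (cong ((- 1#) ^ toℕ j *_) (eq zero j)) (det-cong λ i k → eq (suc i) (punchIn j k))

  module _ {n : ℕ} (A : Subset n) where

    combination-swap : ∀ {r} (v : Matrix (Fin r) (Ground n)) t x →
      combination v t x ≡ combination (λ i → v i ∘ swap A) t (swap A x)
    combination-swap v t x = sum-cong-≗ λ i → cong (λ y → t i * v i y) (sym (swap-involutive A x))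

    -- Permuting the coordinates of all vectors preserves every linear relation, with the same
    -- coefficients.
    rank-interchange : ∀ {P r} → HasRank P r → HasRank (interchange A P) r
    rank-interchange (v , independent , v⊆P , P⊆v) =
      (λ i → v i ∘ swap A) ,
      (λ t z → independent t λ x → R.trans (R.reflexive (combination-swap v t x)) (z (swap A x))) ,
      (λ i → let t , e = v⊆P i in t , e ∘ swap A) ,
      (λ i → let t , e = P⊆v i in t , e ∘ swap A)

    -- This is the contribution of the pair `j`, `j*` to the bilinear form on rows `i` and `k`. It
    -- is symmetric in `j` and `j*`, whereas a single term of an entry of the product is not.
    pairing-interchange : ∀ P i k j →
      left (interchange A P) i j * right (interchange A P) k j +
        left (interchange A P) k j * right (interchange A P) i j
      ≈ᶠ left P i j * right P k j + left P k j * right P i j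
    pairing-interchange P i k j with does (j ∈? A)
    ... | true  = R.trans (R.+-comm _ _) (R.+-cong (R.*-comm _ _) (R.*-comm _ _))
    ... | false = R.refl

    antisymmetric-interchange : ∀ P → Antisymmetric (left P ⊗ right P ᵗ) →
      Antisymmetric (left (interchange A P) ⊗ right (interchange A P) ᵗ)
    -- Antisymmetry is recast as the vanishing of the product plus its transpose, so that the terms
    -- can be compared one `j` at a time.
    antisymmetric-interchange P anti i k = inverseˡ-unique _ _ (begin
      Σ′ i k + Σ′ k i  ≈⟨ ∑-distrib-+ (term P′ i k) (term P′ k i) ⟨
      sum (λ j → term P′ i k j + term P′ k i j)
                       ≈⟨ sum-cong-≋ (pairing-interchange P i k) ⟩
      sum (λ j → term P i k j + term P k i j)
                       ≈⟨ ∑-distrib-+ (term P i k) (term P k i) ⟩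
      Σ₀ i k + Σ₀ k i  ≈⟨ R.+-congʳ (anti i k) ⟩
      - Σ₀ k i + Σ₀ k i ≈⟨ R.-‿inverseˡ _ ⟩
      0# ∎)
      where
      P′ = interchange A P
      term : BlockMatrix n → Fin n → Fin n → Fin n → F
      term Q i k j = left Q i j * right Q k j
      Σ′ Σ₀ : Fin n → Fin n → F
      Σ′ i k = sum (term P′ i k)
      Σ₀ i k = sum (term P i k)

    minor-interchange : ∀ P B → Admissible B → minor (interchange A P) B ≡ minor P (B ∘ swap A)
    minor-interchange P B adm = det-cong λ i j → cong (P i) (swap-select A B adm j)

theorem4p1 : ∀ {a ℓ₁ ℓ₂} (𝔽 : HeytingField a ℓ₁ ℓ₂) → let open LinearAlgebra 𝔽 in
    CharacteristicZero →
    ∀ {n : ℕ} (M : Map n) (A : Subset n) (P : BlockMatrix n) →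
    IsRepresentation P (Δ M) → IsRepresentation (interchange A P) (Δ (∂ M A))
theorem4p1 𝔽 _ M A P rep = record
  { rank          = rank-interchange 𝔽 A {P} rank
  ; antisymmetric = antisymmetric-interchange 𝔽 A P antisymmetric
  ; bases         = λ B adm →
      subst (λ d → Surface.Base (∂ M A) B ⇔ (d # 0#)) (sym (minor-interchange 𝔽 A P B adm))
        (bases (B ∘ swap A) (admissible-swap A B adm) ⇔-∘ base-∂ M A B adm)
  }
  where
  open HeytingField 𝔽 using (_#_; 0#)
  open LinearAlgebra 𝔽
  open IsRepresentation rep
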